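{- For every integer $t\ge 2$, \[ \pi_{\rm link}(t)\le 1-\frac1t-\frac{1}{12t^2}. \]
   Context: A $3$-graph $\mathcal H$ is a collection of $3$-element subsets (edges) of a finite vertex set $V(\mathcal H)$; $|\mathcal H|$ denotes its number of edges. For $v\in V(\mathcal H)$, the link graph of $v$ is the graph $L_{\mathcal H}(v)=\{xy\in\binom{V(\mathcal H)\setminus\{v\}}{2}: vxy\in\mathcal H\}$. Define \[ \operatorname{ex}_{\rm link}(n,t):=\max\{|\mathcal H|: |V(\mathcal H)|=n,\ \chi(L_{\mathcal H}(v))\le t\text{ for every }v\in V(\mathcal H)\}, \] where $\chi$ denotes chromatic number, and $\pi_{\rm link}(t):=\lim_{n\to\infty}\operatorname{ex}_{\rm link}(n,t)/\binom n3$ (this limit exists). -}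

module Defs where

open import Data.Nat as ℕ using (ℕ; NonZero; _≤_)
open import Data.Nat.Combinatorics using (_C_)
open import Data.Integer using (+_)
open import Data.Rational using (ℚ; _/_; 1ℚ; 0ℚ; _+_; _-_; _*_) renaming (_≤_ to _≤ℚ_; _<_ to _<ℚ_)
open import Data.Fin using (Fin; toℕ)
open import Data.List using (List; length)
open import Data.List.Membership.Propositional using (_∈_)
open import Data.List.Relation.Unary.All using (All)
open import Data.List.Relation.Unary.Unique.Propositional using (Unique)
open import Data.Product using (_×_; _,_; ∃-syntax; Σ-syntax)
open import Data.Sum using (_⊎_)
open import Relation.Binary.PropositionalEquality using (_≡_; _≢_)

-- A 3-graph on vertex set Fin n: a duplicate-free list of edges, each edge
-- {a,b,c} stored once as the triple (a,b,c) with a < b < c.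
Triple : ℕ → Set
Triple n = Fin n × Fin n × Fin n

Increasing : ∀ {n} → Triple n → Set
Increasing (a , b , c) = (toℕ a ℕ.< toℕ b) × (toℕ b ℕ.< toℕ c)

record ThreeGraph (n : ℕ) : Set where
  field
    edges      : List (Triple n)
    increasing : All Increasing edges
    distinct   : Unique edges
open ThreeGraph public

size : ∀ {n} → ThreeGraph n → ℕ
size H = length (edges H)

_∈ₑ_ : ∀ {n} → Fin n → Triple n → Set
x ∈ₑ (a , b , c) = x ≡ a ⊎ x ≡ b ⊎ x ≡ c

IsEdge : ∀ {n} → ThreeGraph n → Fin n → Fin n → Fin n → Set
IsEdge H v x y =
  (v ≢ x) × (v ≢ y) × (x ≢ y) ×
  (∃[ e ] (e ∈ edges H × v ∈ₑ e × x ∈ₑ e × y ∈ₑ e))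

LinkEdge : ∀ {n} → ThreeGraph n → Fin n → Fin n → Fin n → Set
LinkEdge H v x y = IsEdge H v x y

-- χ(L_H(v)) ≤ t : the link graph admits a proper colouring with t colours.
-- (Colouring all of Fin n is harmless: v is isolated in its own link.)
LinkChromaticAtMost : ∀ {n} → ℕ → ThreeGraph n → Fin n → Set
LinkChromaticAtMost {n} t H v =
  Σ[ col ∈ (Fin n → Fin t) ] (∀ x y → LinkEdge H v x y → col x ≢ col y)

AllLinksChromaticAtMost : ∀ {n} → ℕ → ThreeGraph n → Set
AllLinksChromaticAtMost t H = ∀ v → LinkChromaticAtMost t H v

ℕ→ℚ : ℕ → ℚ
ℕ→ℚ k = + k / 1

-- π_link(t) ≤ c.  Since the limit π_link(t) = lim ex_link(n,t)/C(n,3) exists,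
-- this is equivalent to: for every ε > 0, for all sufficiently large n,
-- every 3-graph H on n vertices all of whose links are t-colourable
-- satisfies |H| ≤ (c + ε)·C(n,3)  (i.e. ex_link(n,t) ≤ (c+ε)·C(n,3)).
πlink≤ : ℕ → ℚ → Set
πlink≤ t c =
  ∀ (ε : ℚ) → 0ℚ <ℚ ε →
  ∃[ N ] (∀ (n : ℕ) → N ≤ n → (H : ThreeGraph n) → AllLinksChromaticAtMost t H →
          ℕ→ℚ (size H) ≤ℚ (c + ε) * ℕ→ℚ (n C 3))

bound : (t : ℕ) → .{{NonZero t}} → ℚ
bound t = 1ℚ - (+ 1 / t) - (+ 1 / 12) * (+ 1 / t) * (+ 1 / t)

{-# OPTIONS --safe #-}
module Submission where

-- Write y ~ᵥ z if y and z get the same colour in the link of v.  Call an ordered triple (x, y, z), repetitions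
-- allowed, blocked if y ~ z for x, or x ~ z for y, or x ~ y for z; edges are not blocked.  The triples with y ~ₓ z
-- alone have density at least 1/t.  Let D count the blocked triples with y ≁ₓ z.  If D = 0, each relation x ~ᵥ y can
-- be re-centred at any vertex of its triple.  Then x ~ᵥ y ~ᵥ w makes xyw blocked, and moreover a class of v not
-- containing w is cut by the colouring of w into at most t parts, giving further blocked triples xyw with x ~ᵥ y.
-- Re-centred at y, both kinds of quadruples satisfy v ~ x ~ w, but there are only as many of these as of the first
-- kind.  In general every re-centring fails for at most n D quadruples and four are used, so that
-- n Σk² − Σk³ ≤ 4 t n D  with k running over the colour class sizes.  Convexity in k (tangent at k = n/t) then
-- gives density at least 1/t + (t − 1)/(4t³) ≥ 1/t + 1/(8t²) of blocked triples.

open import Defs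
open import Data.Nat using (ℕ; NonZero; zero; suc; z≤n)
import Data.Nat as ℕ
import Data.Nat.Properties as ℕₚ
open import Data.Nat.Combinatorics using (_C_; nCk+nC[k+1]≡[n+1]C[k+1]; nC1≡n)
open import Data.Integer using (ℤ; +_; -[1+_]; -_; 0ℤ; 1ℤ; _+_; _-_; _*_; _≤_; +≤+; nonNegative)
import Data.Integer.Properties as ℤₚ
open import Data.Integer.Tactic.RingSolver using (solve-∀)
open import Data.Rational using (ℚ)
import Data.Rational as ℚ
import Data.Rational.Properties as ℚₚ
import Data.Rational.Solver as ℚ-Solver
import Data.Rational.Unnormalised as ℚᵘ
import Data.Rational.Unnormalised.Properties as ℚᵘₚ
open import Data.Fin using (Fin; zero; suc; _≟_)
import Data.Fin as Fin
import Data.Fin.Properties as Finₚ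
open import Data.List using (List; []; _∷_; length)
open import Data.List.Membership.Propositional using (_∈_)
open import Data.List.Relation.Unary.All as All using (All; []; _∷_)
open import Data.List.Relation.Unary.AllPairs using ([]; _∷_)
open import Data.List.Relation.Unary.Unique.Propositional using (Unique)
open import Data.Product using (_,_; proj₁; proj₂)
open import Data.Product.Properties using (≡-dec)
open import Data.Sum using (_⊎_; inj₁; inj₂)
open import Data.Bool using (if_then_else_)
open import Data.Empty using (⊥-elim)
open import Relation.Nullary using (Dec; yes; no; does; ¬_)
open import Relation.Nullary.Decidable using (_⊎-dec_)
open import Relation.Binary.PropositionalEquality using (_≡_; _≢_; refl; sym; trans; cong; cong₂; subst; module ≡-Reasoning)
open import Algebra.Properties.Semiring.Sum ℤₚ.+-*-semiring using (∑-comm; ∑-distrib-+; *-distribˡ-sum; *-distribʳ-sum) renaming (sum to ∑; sum-cong-≗ to ∑-cong)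

-- Inequalities and finite sums over the integers.

-- The pattern for all polynomial inequalities below: `d` is a combination of visibly nonnegative
-- terms, and the ring solver checks that it equals the difference of the two sides.
≤-by-difference : ∀ {i j d} → 0ℤ ≤ d → d ≡ j - i → i ≤ j
≤-by-difference 0≤d d≡j-i = ℤₚ.0≤i-j⇒j≤i (subst (0ℤ ≤_) d≡j-i 0≤d)

0≤+ : ∀ {i j} → 0ℤ ≤ i → 0ℤ ≤ j → 0ℤ ≤ i + j
0≤+ = ℤₚ.+-mono-≤

0≤* : ∀ {i j} → 0ℤ ≤ i → 0ℤ ≤ j → 0ℤ ≤ i * j
0≤* {+ m} {+ n} _ _ = subst (0ℤ ≤_) (ℤₚ.pos-* m n) (+≤+ z≤n)

0≤square : ∀ i → 0ℤ ≤ i * i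
0≤square (+ n)    = 0≤* {+ n} {+ n} (+≤+ z≤n) (+≤+ z≤n)
0≤square -[1+ n ] = +≤+ z≤n

0≤+n : ∀ {n} → 0ℤ ≤ + n
0≤+n = +≤+ z≤n

∑-mono : ∀ {n} {f g : Fin n → ℤ} → (∀ i → f i ≤ g i) → ∑ f ≤ ∑ g
∑-mono {zero}  f≤g = ℤₚ.≤-refl
∑-mono {suc n} f≤g = ℤₚ.+-mono-≤ (f≤g zero) (∑-mono (λ i → f≤g (suc i)))

∑-const : ∀ n c → ∑ {n} (λ _ → c) ≡ + n * c
∑-const zero    c = sym (ℤₚ.*-zeroˡ c)
∑-const (suc n) c = begin
  c + ∑ {n} (λ _ → c)  ≡⟨ cong₂ _+_ (refl {x = c}) (∑-const n c) ⟩
  c + + n * c          ≡⟨ lemma c (+ n) ⟩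
  (1ℤ + + n) * c       ∎
  where
  open ≡-Reasoning
  lemma : ∀ c n → c + n * c ≡ (1ℤ + n) * c
  lemma = solve-∀

∑-nonneg : ∀ {n} {f : Fin n → ℤ} → (∀ i → 0ℤ ≤ f i) → 0ℤ ≤ ∑ f
∑-nonneg {zero}  0≤f = ℤₚ.≤-refl
∑-nonneg {suc n} 0≤f = 0≤+ (0≤f zero) (∑-nonneg (λ i → 0≤f (suc i)))

∑-*ˡ : ∀ {n} c (f : Fin n → ℤ) → ∑ (λ i → c * f i) ≡ c * ∑ f
∑-*ˡ c f = sym (*-distribˡ-sum c f)

∑-*ʳ : ∀ {n} (f : Fin n → ℤ) c → ∑ (λ i → f i * c) ≡ ∑ f * c
∑-*ʳ f c = sym (*-distribʳ-sum c f)

∑-neg : ∀ {n} (f : Fin n → ℤ) → ∑ (λ i → - f i) ≡ - ∑ f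
∑-neg {zero}  f = refl
∑-neg {suc n} f = trans (cong₂ _+_ (refl {x = - f zero}) (∑-neg (λ i → f (suc i)))) (sym (ℤₚ.neg-distrib-+ (f zero) _))

∑-sub : ∀ {n} (f g : Fin n → ℤ) → ∑ (λ i → f i - g i) ≡ ∑ f - ∑ g
∑-sub f g = trans (∑-distrib-+ f (λ i → - g i)) (cong₂ _+_ (refl {x = ∑ f}) (∑-neg g))

∑-product : ∀ {m n} (f : Fin m → ℤ) (g : Fin n → ℤ) → ∑ (λ i → ∑ λ j → f i * g j) ≡ ∑ f * ∑ g
∑-product f g = trans (∑-cong (λ i → ∑-*ˡ (f i) g)) (∑-*ʳ f (∑ g))

∑-reverse₃ : ∀ {l m n} (f : Fin l → Fin m → Fin n → ℤ) →
             ∑ (λ i → ∑ λ j → ∑ λ k → f i j k) ≡ ∑ (λ k → ∑ λ j → ∑ λ i → f i j k)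
∑-reverse₃ f = begin
  ∑ (λ i → ∑ λ j → ∑ λ k → f i j k)  ≡⟨ ∑-cong (λ i → ∑-comm (f i)) ⟩
  ∑ (λ i → ∑ λ k → ∑ λ j → f i j k)  ≡⟨ ∑-comm (λ i k → ∑ λ j → f i j k) ⟩
  ∑ (λ k → ∑ λ i → ∑ λ j → f i j k)  ≡⟨ ∑-cong (λ k → ∑-comm (λ i j → f i j k)) ⟩
  ∑ (λ k → ∑ λ j → ∑ λ i → f i j k)  ∎
  where open ≡-Reasoning

∑-rotate₃ : ∀ {l m n} (f : Fin l → Fin m → Fin n → ℤ) →
            ∑ (λ i → ∑ λ j → ∑ λ k → f i j k) ≡ ∑ (λ k → ∑ λ i → ∑ λ j → f i j k)
∑-rotate₃ f = trans (∑-reverse₃ f) (∑-cong (λ k → ∑-comm (λ j i → f i j k)))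

∑-reverse₄ : ∀ {l m n o} (f : Fin l → Fin m → Fin n → Fin o → ℤ) →
             ∑ (λ i → ∑ λ j → ∑ λ k → ∑ λ h → f i j k h) ≡ ∑ (λ h → ∑ λ k → ∑ λ j → ∑ λ i → f i j k h)
∑-reverse₄ f = begin
  ∑ (λ i → ∑ λ j → ∑ λ k → ∑ λ h → f i j k h)  ≡⟨ ∑-cong (λ i → ∑-reverse₃ (f i)) ⟩
  ∑ (λ i → ∑ λ h → ∑ λ k → ∑ λ j → f i j k h)  ≡⟨ ∑-comm (λ i h → ∑ λ k → ∑ λ j → f i j k h) ⟩
  ∑ (λ h → ∑ λ i → ∑ λ k → ∑ λ j → f i j k h)  ≡⟨ ∑-cong (λ h → ∑-rotate (λ i k j → f i j k h)) ⟩
  ∑ (λ h → ∑ λ k → ∑ λ j → ∑ λ i → f i j k h)  ∎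
  where
  open ≡-Reasoning
  ∑-rotate : ∀ {l m n} (g : Fin l → Fin m → Fin n → ℤ) →
             ∑ (λ i → ∑ λ j → ∑ λ k → g i j k) ≡ ∑ (λ j → ∑ λ k → ∑ λ i → g i j k)
  ∑-rotate g = sym (∑-rotate₃ (λ j k i → g i j k))

-- Indicators and sizes of colour classes.

[_] : ∀ {p} {P : Set p} → Dec P → ℤ
[ P? ] = if does P? then 1ℤ else 0ℤ

module _ {p} {P : Set p} where

  []≡1 : (P? : Dec P) → P → [ P? ] ≡ 1ℤ
  []≡1 (yes _)  _ = refl
  []≡1 (no ¬p) p  = ⊥-elim (¬p p)

  []≡0 : (P? : Dec P) → ¬ P → [ P? ] ≡ 0ℤ
  []≡0 (yes p) ¬p = ⊥-elim (¬p p)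
  []≡0 (no _)  _  = refl

  0≤[] : (P? : Dec P) → 0ℤ ≤ [ P? ]
  0≤[] (yes _) = +≤+ z≤n
  0≤[] (no _)  = +≤+ z≤n

  []≤1 : (P? : Dec P) → [ P? ] ≤ 1ℤ
  []≤1 (yes _) = ℤₚ.≤-refl
  []≤1 (no _)  = +≤+ z≤n

δ : ∀ {n} → Fin n → Fin n → ℤ
δ x y = [ x ≟ y ]

δ-suc : ∀ {n} (x y : Fin n) → δ (suc x) (suc y) ≡ δ x y
δ-suc x y with x ≟ y
... | yes _ = refl
... | no _  = refl

δ-sym : ∀ {n} (x y : Fin n) → δ x y ≡ δ y x
δ-sym x y with x ≟ y
... | yes refl = sym ([]≡1 (x ≟ x) refl)
... | no x≢y   = sym ([]≡0 (y ≟ x) (λ y≡x → x≢y (sym y≡x)))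

∑-δ : ∀ {n} (x : Fin n) (f : Fin n → ℤ) → ∑ (λ i → δ x i * f i) ≡ f x
∑-δ {suc n} zero f = begin
  1ℤ * f zero + ∑ {n} (λ i → 0ℤ * f (suc i))  ≡⟨ cong₂ _+_ (ℤₚ.*-identityˡ (f zero)) (trans (∑-*ˡ 0ℤ (λ i → f (suc i))) (ℤₚ.*-zeroˡ (∑ (λ i → f (suc i))))) ⟩
  f zero + 0ℤ                                 ≡⟨ ℤₚ.+-identityʳ _ ⟩
  f zero                                      ∎
  where open ≡-Reasoning
∑-δ {suc n} (suc x) f = begin
  0ℤ * f zero + ∑ {n} (λ i → δ (suc x) (suc i) * f (suc i))  ≡⟨ cong₂ _+_ (ℤₚ.*-zeroˡ (f zero)) (∑-cong (λ i → cong (_* f (suc i)) (δ-suc x i))) ⟩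
  0ℤ + ∑ {n} (λ i → δ x i * f (suc i))                       ≡⟨ ℤₚ.+-identityˡ _ ⟩
  ∑ {n} (λ i → δ x i * f (suc i))                            ≡⟨ ∑-δ x (λ i → f (suc i)) ⟩
  f (suc x)                                                  ∎
  where open ≡-Reasoning

fibre : ∀ {n t} → (Fin n → Fin t) → Fin t → ℤ
fibre c i = ∑ λ x → δ i (c x)

∑-fibre : ∀ {n t} (c : Fin n → Fin t) (g : Fin t → ℤ) → ∑ (λ x → g (c x)) ≡ ∑ (λ i → fibre c i * g i)
∑-fibre c g = begin
  ∑ (λ x → g (c x))                       ≡⟨ ∑-cong (λ x → sym (∑-δ (c x) g)) ⟩
  ∑ (λ x → ∑ λ i → δ (c x) i * g i)       ≡⟨ ∑-comm (λ x i → δ (c x) i * g i) ⟩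
  ∑ (λ i → ∑ λ x → δ (c x) i * g i)       ≡⟨ ∑-cong (λ i → ∑-*ʳ (λ x → δ (c x) i) (g i)) ⟩
  ∑ (λ i → ∑ (λ x → δ (c x) i) * g i)     ≡⟨ ∑-cong (λ i → cong (_* g i) (∑-cong (λ x → δ-sym (c x) i))) ⟩
  ∑ (λ i → fibre c i * g i)               ∎
  where open ≡-Reasoning

∑-fibre-sizes : ∀ {n t} (c : Fin n → Fin t) → ∑ (fibre c) ≡ + n
∑-fibre-sizes {n} c = begin
  ∑ (fibre c)                       ≡⟨ ∑-cong (λ i → sym (ℤₚ.*-identityʳ (fibre c i))) ⟩
  ∑ (λ i → fibre c i * 1ℤ)          ≡⟨ sym (∑-fibre c (λ _ → 1ℤ)) ⟩
  ∑ {n} (λ _ → 1ℤ)                  ≡⟨ ∑-const n 1ℤ ⟩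
  + n * 1ℤ                          ≡⟨ ℤₚ.*-identityʳ (+ n) ⟩
  + n                               ∎
  where open ≡-Reasoning

fibre≤ : ∀ {n t} (c : Fin n → Fin t) i → fibre c i ≤ + n
fibre≤ {n} c i = ℤₚ.≤-trans (∑-mono (λ x → []≤1 (i ≟ c x)))
  (ℤₚ.≤-reflexive (trans (∑-const n 1ℤ) (ℤₚ.*-identityʳ (+ n))))

-- Cauchy-Schwarz for colourings.

-- Lagrange's identity: the squares `(a i - a j)²` over all ordered pairs add up to twice the
-- difference of the two sides, hence the cancelled factor 2.
cauchy-schwarz : ∀ {t} (a : Fin t → ℤ) → ∑ a * ∑ a ≤ + t * ∑ (λ i → a i * a i)
cauchy-schwarz {t} a = ℤₚ.*-cancelˡ-≤-pos _ _ (+ 2) (≤-by-difference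
  (∑-nonneg (λ i → ∑-nonneg (λ j → 0≤square (a i - a j))))
  (begin
    ∑ (λ i → ∑ λ j → (a i - a j) * (a i - a j))
      ≡⟨ ∑-cong (λ i → inner i) ⟩
    ∑ (λ i → (+ t * (a i * a i) + S) - (+ 2 * s) * a i)
      ≡⟨ ∑-sub (λ i → + t * (a i * a i) + S) (λ i → (+ 2 * s) * a i) ⟩
    ∑ (λ i → + t * (a i * a i) + S) - ∑ (λ i → (+ 2 * s) * a i)
      ≡⟨ cong₂ _-_ (trans (∑-distrib-+ (λ i → + t * (a i * a i)) (λ _ → S)) (cong₂ _+_ (∑-*ˡ (+ t) (λ i → a i * a i)) (∑-const t S))) (∑-*ˡ (+ 2 * s) a) ⟩
    (+ t * S + + t * S) - (+ 2 * s) * s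
      ≡⟨ arith (+ t) S s ⟩
    + 2 * (+ t * S) - + 2 * (s * s) ∎))
  where
  open ≡-Reasoning
  s = ∑ a
  S = ∑ (λ i → a i * a i)
  expand : ∀ x y → (x - y) * (x - y) ≡ (x * x + y * y) - (+ 2 * x) * y
  expand = solve-∀
  arith : ∀ t S s → (t * S + t * S) - (+ 2 * s) * s ≡ + 2 * (t * S) - + 2 * (s * s)
  arith = solve-∀
  swap : ∀ x s → (+ 2 * x) * s ≡ (+ 2 * s) * x
  swap = solve-∀
  inner : ∀ i → ∑ (λ j → (a i - a j) * (a i - a j)) ≡ (+ t * (a i * a i) + S) - (+ 2 * s) * a i
  inner i = begin
    ∑ (λ j → (a i - a j) * (a i - a j))
      ≡⟨ ∑-cong (λ j → expand (a i) (a j)) ⟩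
    ∑ (λ j → (a i * a i + a j * a j) - (+ 2 * a i) * a j)
      ≡⟨ ∑-sub (λ j → a i * a i + a j * a j) (λ j → (+ 2 * a i) * a j) ⟩
    ∑ (λ j → a i * a i + a j * a j) - ∑ (λ j → (+ 2 * a i) * a j)
      ≡⟨ cong₂ _-_ (trans (∑-distrib-+ (λ _ → a i * a i) (λ j → a j * a j)) (cong (_+ S) (∑-const t (a i * a i)))) (trans (∑-*ˡ (+ 2 * a i) a) (swap (a i) s)) ⟩
    (+ t * (a i * a i) + S) - (+ 2 * s) * a i ∎

-- Cauchy-Schwarz for the total weights of the `t` colour classes of `d`: the square of a class
-- weight expands into the pairs inside that class. If `f` is the indicator of a set of `s`
-- vertices, then at least `s²/t` of its ordered pairs share a colour.
cauchy-schwarz-colour : ∀ {n t} (d : Fin n → Fin t) (f : Fin n → ℤ) →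
  ∑ f * ∑ f ≤ + t * ∑ (λ x → ∑ λ y → f x * f y * δ (d x) (d y))
cauchy-schwarz-colour {n} {t} d f = subst (λ s → s * s ≤ + t * ∑ (λ x → ∑ λ y → f x * f y * δ (d x) (d y))) total
  (subst (λ S → ∑ a * ∑ a ≤ + t * S) squares (cauchy-schwarz a))
  where
  open ≡-Reasoning
  a : Fin t → ℤ
  a i = ∑ λ x → δ (d x) i * f x
  total : ∑ a ≡ ∑ f
  total = trans (∑-comm (λ i x → δ (d x) i * f x)) (∑-cong (λ x → ∑-δ (d x) (λ _ → f x)))
  regroup : ∀ p x q y → (p * x) * (q * y) ≡ p * (x * y * q)
  regroup = solve-∀
  squares : ∑ (λ i → a i * a i) ≡ ∑ (λ x → ∑ λ y → f x * f y * δ (d x) (d y))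
  squares = begin
    ∑ (λ i → a i * a i)
      ≡⟨ ∑-cong (λ i → sym (∑-product (λ x → δ (d x) i * f x) (λ x → δ (d x) i * f x))) ⟩
    ∑ (λ i → ∑ λ x → ∑ λ y → (δ (d x) i * f x) * (δ (d y) i * f y))
      ≡⟨ sym (∑-rotate₃ (λ x y i → (δ (d x) i * f x) * (δ (d y) i * f y))) ⟩
    ∑ (λ x → ∑ λ y → ∑ λ i → (δ (d x) i * f x) * (δ (d y) i * f y))
      ≡⟨ ∑-cong (λ x → ∑-cong (λ y → trans (∑-cong (λ i → regroup (δ (d x) i) (f x) (δ (d y) i) (f y))) (trans (∑-δ (d x) (λ i → f x * f y * δ (d y) i)) (cong (f x * f y *_) (δ-sym (d y) (d x)))))) ⟩
    ∑ (λ x → ∑ λ y → f x * f y * δ (d x) (d y)) ∎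

-- Blocked triples and re-centring for one colouring per vertex.

-- The two products are indicators of mutually exclusive events, separated by `Q`, so their sum is 0
-- or 1 and `k` must reach 1 only when one of the events occurs.
split-indicator≤ : ∀ {p q r} {P : Set p} {Q : Set q} {R : Set r} {k} (P? : Dec P) (Q? : Dec Q) (R? : Dec R) →
              0ℤ ≤ k → (P → Q → 1ℤ ≤ k) → (P → R → 1ℤ ≤ k) →
              [ P? ] * (1ℤ - [ Q? ]) * [ R? ] + [ P? ] * [ Q? ] ≤ k
split-indicator≤ (no _)  (yes _) (yes _) 0≤k f g = 0≤k
split-indicator≤ (no _)  (yes _) (no _)  0≤k f g = 0≤k
split-indicator≤ (no _)  (no _)  (yes _) 0≤k f g = 0≤k
split-indicator≤ (no _)  (no _)  (no _)  0≤k f g = 0≤k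
split-indicator≤ (yes p) (yes q) (yes _) 0≤k f g = f p q
split-indicator≤ (yes p) (yes q) (no _)  0≤k f g = f p q
split-indicator≤ (yes p) (no _)  (yes r) 0≤k f g = g p r
split-indicator≤ (yes _) (no _)  (no _)  0≤k f g = 0≤k

module Colourings {n t : ℕ} (c : Fin n → Fin n → Fin t) where

  Blocked : Fin n → Fin n → Fin n → Set
  Blocked x y z = c x y ≡ c x z ⊎ c y x ≡ c y z ⊎ c z x ≡ c z y

  blocked? : ∀ x y z → Dec (Blocked x y z)
  blocked? x y z = c x y ≟ c x z ⊎-dec c y x ≟ c y z ⊎-dec c z x ≟ c z y

  mono : Fin n → Fin n → Fin n → ℤ
  mono v x y = δ (c v x) (c v y)

  -- A triple with `c x y ≡ c x z` is blocked, so the difference is again an indicator: that of the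
  -- blocked triples whose first vertex separates the other two.
  blocked excess : Fin n → Fin n → Fin n → ℤ
  blocked x y z = [ blocked? x y z ]
  excess  x y z = blocked x y z - mono x y z

  0≤excess : ∀ x y z → 0ℤ ≤ excess x y z
  0≤excess x y z with c x y ≟ c x z
  ... | yes _ = ℤₚ.≤-refl
  ... | no _  = subst (0ℤ ≤_) (sym (ℤₚ.+-identityʳ _)) (0≤[] (c y x ≟ c y z ⊎-dec c z x ≟ c z y))

  1≤excess : ∀ x y z → Blocked x y z → c x y ≢ c x z → 1ℤ ≤ excess x y z
  1≤excess x y z b ¬m = ℤₚ.≤-reflexive (sym (cong₂ _-_ ([]≡1 (blocked? x y z) b) ([]≡0 (c x y ≟ c x z) ¬m)))

  private
    0≤mono : ∀ v x y → 0ℤ ≤ mono v x y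
    0≤mono v x y = 0≤[] (c v x ≟ c v y)

  module _ (v w x y : Fin n) where
    private
      -- `T` is the quadruple after re-centring at `y`; each `E` records that one re-centring, at
      -- `x` or at `y`, fails.
      T E₁ E₂ E₃ E₄ : ℤ
      T  = mono y x w * mono y x v
      E₁ = excess x v w
      E₂ = excess x v y
      E₃ = excess y x w
      E₄ = excess y x v

      0≤T : 0ℤ ≤ T
      0≤T = 0≤* (0≤mono y x w) (0≤mono y x v)

      0≤E₁ = 0≤excess x v w
      0≤E₂ = 0≤excess x v y
      0≤E₃ = 0≤excess y x w
      0≤E₄ = 0≤excess y x v

      rhs : ℤ
      rhs = T + (E₁ + E₂ + E₃ + E₄)

      0≤rhs : 0ℤ ≤ rhs
      0≤rhs = 0≤+ 0≤T (0≤+ (0≤+ (0≤+ 0≤E₁ 0≤E₂) 0≤E₃) 0≤E₄)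

      by-T : 1ℤ ≤ T → 1ℤ ≤ rhs
      by-T 1≤T = ℤₚ.+-mono-≤ 1≤T (0≤+ (0≤+ (0≤+ 0≤E₁ 0≤E₂) 0≤E₃) 0≤E₄)

      by-E₁ : 1ℤ ≤ E₁ → 1ℤ ≤ rhs
      by-E₁ 1≤E = ℤₚ.+-mono-≤ 0≤T (ℤₚ.+-mono-≤ (ℤₚ.+-mono-≤ (ℤₚ.+-mono-≤ 1≤E 0≤E₂) 0≤E₃) 0≤E₄)

      by-E₂ : 1ℤ ≤ E₂ → 1ℤ ≤ rhs
      by-E₂ 1≤E = ℤₚ.+-mono-≤ 0≤T (ℤₚ.+-mono-≤ (ℤₚ.+-mono-≤ (ℤₚ.+-mono-≤ 0≤E₁ 1≤E) 0≤E₃) 0≤E₄)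

      by-E₃ : 1ℤ ≤ E₃ → 1ℤ ≤ rhs
      by-E₃ 1≤E = ℤₚ.+-mono-≤ 0≤T (ℤₚ.+-mono-≤ (ℤₚ.+-mono-≤ (0≤+ 0≤E₁ 0≤E₂) 1≤E) 0≤E₄)

      by-E₄ : 1ℤ ≤ E₄ → 1ℤ ≤ rhs
      by-E₄ 1≤E = ℤₚ.+-mono-≤ 0≤T (ℤₚ.+-mono-≤ (0≤+ (0≤+ 0≤E₁ 0≤E₂) 0≤E₃) 1≤E)

      -- The move to `y`: both `(y, x, w)` and `(y, x, v)` are blocked, the latter through `v`.
      -- Either one of them is an excess, or `y` sees both `w` and `v` in the colour of `x`.
      from-blocked : c v x ≡ c v y → Blocked y x w → 1ℤ ≤ rhs
      from-blocked vxy b = go (c y x ≟ c y w) (c y x ≟ c y v)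
        where
        go : Dec (c y x ≡ c y w) → Dec (c y x ≡ c y v) → 1ℤ ≤ rhs
        go (no ¬p) _       = by-E₃ (1≤excess y x w b ¬p)
        go (yes _) (no ¬q) = by-E₄ (1≤excess y x v (inj₂ (inj₂ (sym vxy))) ¬q)
        go (yes p) (yes q) = by-T (ℤₚ.≤-reflexive (sym (cong₂ _*_ ([]≡1 (c y x ≟ c y w) p) ([]≡1 (c y x ≟ c y v) q))))

      -- A first move, from `v` to `x`. If neither re-centring fails, `w` and `y` both have the
      -- colour of `v` in the link of `x`; transitivity gives `c x y ≡ c x w`, which blocks
      -- `(y, x, w)`.
      from-triangle : c v x ≡ c v y → c v x ≡ c v w → 1ℤ ≤ rhs
      from-triangle vxy vxw = go (c x v ≟ c x w) (c x v ≟ c x y)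
        where
        go : Dec (c x v ≡ c x w) → Dec (c x v ≡ c x y) → 1ℤ ≤ rhs
        go (no ¬p) _       = by-E₁ (1≤excess x v w (inj₂ (inj₁ vxw)) ¬p)
        go (yes _) (no ¬q) = by-E₂ (1≤excess x v y (inj₂ (inj₁ vxy)) ¬q)
        go (yes p) (yes q) = from-blocked vxy (inj₂ (inj₁ (trans (sym q) p)))

    -- Both kinds of quadruples have `c v x ≡ c v y` and lead to a blocked `(y, x, w)`: in the first
    -- kind directly through `w`, in the second through `x` after a re-centring there.
    crossing-or-cherry≤ : mono v x y * (1ℤ - mono v x w) * mono w x y + mono v x y * mono v x w
              ≤ mono y x w * mono y x v + (excess x v w + excess x v y + excess y x w + excess y x v)
    crossing-or-cherry≤ = split-indicator≤ (c v x ≟ c v y) (c v x ≟ c v w) (c w x ≟ c w y) 0≤rhs from-triangle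
      (λ vxy wxy → from-blocked vxy (inj₂ (inj₂ (sym wxy))))

  -- Double counting of quadruples.

  #mono #blocked ∑k³ : ℤ
  #mono    = ∑ λ x → ∑ λ y → ∑ λ z → mono x y z
  #blocked = ∑ λ x → ∑ λ y → ∑ λ z → blocked x y z
  ∑k³      = ∑ λ v → ∑ λ i → fibre (c v) i * (fibre (c v) i * fibre (c v) i)

  #excess : ℤ
  #excess = ∑ λ x → ∑ λ y → ∑ λ z → excess x y z

  #excess≡ : #excess ≡ #blocked - #mono
  #excess≡ = trans (∑-cong (λ x → trans (∑-cong (λ y → ∑-sub (blocked x y) (mono x y)))
    (∑-sub (λ y → ∑ (blocked x y)) (λ y → ∑ (mono x y)))))
    (∑-sub (λ x → ∑ λ y → ∑ (blocked x y)) (λ x → ∑ λ y → ∑ (mono x y)))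

  #mono≡∑k² : #mono ≡ ∑ λ v → ∑ λ i → fibre (c v) i * fibre (c v) i
  #mono≡∑k² = ∑-cong (λ v → ∑-fibre (c v) (fibre (c v)))

  -- For fixed `x`, the vertices `y` and `z` range independently over the class of `x`, so `x`
  -- contributes the square of its class size and a class of size `k` contributes `k³`.
  ∑-cherries : ∀ v → ∑ (λ x → ∑ λ y → ∑ λ z → mono v x y * mono v x z) ≡ ∑ (λ i → fibre (c v) i * (fibre (c v) i * fibre (c v) i))
  ∑-cherries v = trans (∑-cong (λ x → ∑-product (mono v x) (mono v x)))
    (∑-fibre (c v) (λ i → fibre (c v) i * fibre (c v) i))

  ∑⁴-cherries-at-v : ∑ (λ v → ∑ λ w → ∑ λ x → ∑ λ y → mono v x y * mono v x w) ≡ ∑k³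
  ∑⁴-cherries-at-v = ∑-cong (λ v → trans (sym (∑-rotate₃ (λ x y w → mono v x y * mono v x w))) (∑-cherries v))

  ∑⁴-cherries-at-y : ∑ (λ v → ∑ λ w → ∑ λ x → ∑ λ y → mono y x w * mono y x v) ≡ ∑k³
  ∑⁴-cherries-at-y = trans (∑-reverse₄ (λ v w x y → mono y x w * mono y x v)) (∑-cong ∑-cherries)

  -- Each of the four excess terms ignores one vertex of the quadruple, which yields the factor
  -- `+ n`; the rest is reordering of sums.
  ∑⁴-excess-xvw : ∑ (λ v → ∑ λ w → ∑ λ x → ∑ λ (y : Fin n) → excess x v w) ≡ + n * #excess
  ∑⁴-excess-xvw = begin
    ∑ (λ v → ∑ λ w → ∑ λ x → ∑ λ (y : Fin n) → excess x v w)
      ≡⟨ ∑-rotate₃ (λ v w x → ∑ λ (y : Fin n) → excess x v w) ⟩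
    ∑ (λ x → ∑ λ v → ∑ λ w → ∑ λ (y : Fin n) → excess x v w)
      ≡⟨ ∑-cong (λ x → trans (∑-cong (λ v → trans (∑-cong (λ w → ∑-const n (excess x v w))) (∑-*ˡ (+ n) (excess x v))))
           (∑-*ˡ (+ n) (λ v → ∑ (excess x v)))) ⟩
    ∑ (λ x → + n * ∑ λ v → ∑ λ w → excess x v w)
      ≡⟨ ∑-*ˡ (+ n) (λ x → ∑ λ v → ∑ (excess x v)) ⟩
    + n * #excess ∎
    where open ≡-Reasoning

  ∑-constant₂ : (f : Fin n → Fin n → Fin n → ℤ) →
    ∑ (λ v → ∑ λ (w : Fin n) → ∑ λ x → ∑ λ y → f v x y) ≡ + n * ∑ (λ v → ∑ λ x → ∑ λ y → f v x y)
  ∑-constant₂ f = trans (∑-cong (λ v → ∑-const n (∑ λ x → ∑ (f v x)))) (∑-*ˡ (+ n) (λ v → ∑ λ x → ∑ (f v x)))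

  ∑⁴-excess-xvy : ∑ (λ v → ∑ λ (w : Fin n) → ∑ λ x → ∑ λ y → excess x v y) ≡ + n * #excess
  ∑⁴-excess-xvy = trans (∑-constant₂ (λ v x y → excess x v y))
    (cong (+ n *_) (∑-comm (λ v x → ∑ (excess x v))))

  ∑⁴-excess-yxw : ∑ (λ (v : Fin n) → ∑ λ w → ∑ λ x → ∑ λ y → excess y x w) ≡ + n * #excess
  ∑⁴-excess-yxw = trans (∑-const n (∑ λ w → ∑ λ x → ∑ λ y → excess y x w))
    (cong (+ n *_) (∑-reverse₃ (λ w x y → excess y x w)))

  ∑⁴-excess-yxv : ∑ (λ v → ∑ λ (w : Fin n) → ∑ λ x → ∑ λ y → excess y x v) ≡ + n * #excess
  ∑⁴-excess-yxv = trans (∑-constant₂ (λ v x y → excess y x v))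
    (cong (+ n *_) (∑-reverse₃ (λ v x y → excess y x v)))

  ∑⁴ : (Fin n → Fin n → Fin n → Fin n → ℤ) → ℤ
  ∑⁴ f = ∑ λ v → ∑ λ w → ∑ λ x → ∑ λ y → f v w x y

  ∑⁴-+ : ∀ f g → ∑⁴ (λ v w x y → f v w x y + g v w x y) ≡ ∑⁴ f + ∑⁴ g
  ∑⁴-+ f g = trans (∑-cong (λ v → trans (∑-cong (λ w → trans (∑-cong (λ x →
      ∑-distrib-+ (f v w x) (g v w x)))
      (∑-distrib-+ (λ x → ∑ (f v w x)) (λ x → ∑ (g v w x)))))
      (∑-distrib-+ (λ w → ∑ λ x → ∑ (f v w x)) (λ w → ∑ λ x → ∑ (g v w x)))))
      (∑-distrib-+ (λ v → ∑ λ w → ∑ λ x → ∑ (f v w x)) (λ v → ∑ λ w → ∑ λ x → ∑ (g v w x)))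

  ∑⁴-mono : ∀ {f g} → (∀ v w x y → f v w x y ≤ g v w x y) → ∑⁴ f ≤ ∑⁴ g
  ∑⁴-mono f≤g = ∑-mono λ v → ∑-mono λ w → ∑-mono λ x → ∑-mono λ y → f≤g v w x y

  crossing : Fin n → Fin n → Fin n → Fin n → ℤ
  crossing v w x y = mono v x y * (1ℤ - mono v x w) * mono w x y

  -- The pointwise bound is summed over all quadruples. Renaming the vertices carries cherries seen
  -- from `y` to cherries seen from `v`, so both sides contain the same `∑k³`; only the four error
  -- terms are left.
  crossing-upper : ∑⁴ crossing ≤ + 4 * + n * #excess
  crossing-upper = ≤-by-difference (ℤₚ.i≤j⇒0≤j-i summed) (cancel (∑⁴ crossing) ∑k³ (+ n) #excess)
    where
    cancel : ∀ b s n d → (s + (n * d + n * d + n * d + n * d)) - (b + s) ≡ + 4 * n * d - b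
    cancel = solve-∀
    summed : ∑⁴ crossing + ∑k³ ≤ ∑k³ + (+ n * #excess + + n * #excess + + n * #excess + + n * #excess)
    summed = begin
      ∑⁴ crossing + ∑k³
        ≡⟨ cong₂ _+_ (refl {x = ∑⁴ crossing}) (sym ∑⁴-cherries-at-v) ⟩
      ∑⁴ crossing + ∑⁴ (λ v w x y → mono v x y * mono v x w)
        ≡⟨ sym (∑⁴-+ crossing (λ v w x y → mono v x y * mono v x w)) ⟩
      ∑⁴ (λ v w x y → crossing v w x y + mono v x y * mono v x w)
        ≤⟨ ∑⁴-mono crossing-or-cherry≤ ⟩
      ∑⁴ (λ v w x y → mono y x w * mono y x v + (excess x v w + excess x v y + excess y x w + excess y x v))
        ≡⟨ ∑⁴-+ (λ v w x y → mono y x w * mono y x v) (λ v w x y → excess x v w + excess x v y + excess y x w + excess y x v) ⟩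
      ∑⁴ (λ v w x y → mono y x w * mono y x v) + ∑⁴ (λ v w x y → excess x v w + excess x v y + excess y x w + excess y x v)
        ≡⟨ cong₂ _+_ ∑⁴-cherries-at-y (trans (∑⁴-+ (λ v w x y → excess x v w + excess x v y + excess y x w) (λ v w x y → excess y x v))
            (cong₂ _+_ (trans (∑⁴-+ (λ v w x y → excess x v w + excess x v y) (λ v w x y → excess y x w))
              (cong₂ _+_ (trans (∑⁴-+ (λ v w x y → excess x v w) (λ v w x y → excess x v y)) (cong₂ _+_ ∑⁴-excess-xvw ∑⁴-excess-xvy)) ∑⁴-excess-yxw)) ∑⁴-excess-yxv)) ⟩
      ∑k³ + (+ n * #excess + + n * #excess + + n * #excess + + n * #excess) ∎
      where open ℤₚ.≤-Reasoning

  -- Fix `v` and `w`. A class of `v` of size `k` that misses `w` is cut by the colouring of `w` into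
  -- at most `t` parts, so at least `k²/t` of its pairs stay together. Such a class misses `n - k`
  -- choices of `w`, whence the total of `(n - k) k²`.
  crossing-lower : + n * #mono - ∑k³ ≤ + t * ∑⁴ crossing
  crossing-lower = begin
    + n * #mono - ∑k³
      ≡⟨ cong₂ _-_ (trans (cong (+ n *_) #mono≡∑k²) (sym (∑-*ˡ (+ n) (λ v → ∑ (sq v))))) refl ⟩
    ∑ (λ v → + n * ∑ (sq v)) - ∑k³
      ≡⟨ sym (∑-sub (λ v → + n * ∑ (sq v)) (λ v → ∑ λ i → k v i * sq v i)) ⟩
    ∑ (λ v → + n * ∑ (sq v) - ∑ λ i → k v i * sq v i)
      ≡⟨ ∑-cong (λ v → sym (sum-w v)) ⟩
    ∑ (λ v → ∑ λ w → ∑ λ i → (1ℤ - δ i (c v w)) * sq v i)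
      ≤⟨ ∑-mono (λ v → ∑-mono (λ w → step v w)) ⟩
    ∑ (λ v → ∑ λ w → + t * ∑ λ x → ∑ λ y → crossing v w x y)
      ≡⟨ trans (∑-cong (λ v → ∑-*ˡ (+ t) (λ w → ∑ λ x → ∑ (crossing v w x)))) (∑-*ˡ (+ t) (λ v → ∑ λ w → ∑ λ x → ∑ (crossing v w x))) ⟩
    + t * ∑⁴ crossing ∎
    where
    open ℤₚ.≤-Reasoning
    k sq : Fin n → Fin t → ℤ
    k v = fibre (c v)
    sq v i = k v i * k v i

    sum-w : ∀ v → ∑ (λ w → ∑ λ i → (1ℤ - δ i (c v w)) * sq v i) ≡ + n * ∑ (sq v) - ∑ (λ i → k v i * sq v i)
    sum-w v = begin-equality
      ∑ (λ w → ∑ λ i → (1ℤ - δ i (c v w)) * sq v i)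
        ≡⟨ ∑-comm (λ w i → (1ℤ - δ i (c v w)) * sq v i) ⟩
      ∑ (λ i → ∑ λ w → (1ℤ - δ i (c v w)) * sq v i)
        ≡⟨ ∑-cong (λ i → trans (∑-*ʳ (λ w → 1ℤ - δ i (c v w)) (sq v i))
             (trans (cong (_* sq v i) (trans (∑-sub (λ _ → 1ℤ) (λ w → δ i (c v w))) (cong (_- k v i) (trans (∑-const n 1ℤ) (ℤₚ.*-identityʳ (+ n))))))
               (distrib (+ n) (k v i) (sq v i)))) ⟩
      ∑ (λ i → + n * sq v i - k v i * sq v i)
        ≡⟨ ∑-sub (λ i → + n * sq v i) (λ i → k v i * sq v i) ⟩
      ∑ (λ i → + n * sq v i) - ∑ (λ i → k v i * sq v i)
        ≡⟨ cong (_- ∑ (λ i → k v i * sq v i)) (∑-*ˡ (+ n) (sq v)) ⟩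
      + n * ∑ (sq v) - ∑ (λ i → k v i * sq v i) ∎
      where
      distrib : ∀ n k s → (n - k) * s ≡ n * s - k * s
      distrib = solve-∀

    step : ∀ v w → ∑ (λ i → (1ℤ - δ i (c v w)) * sq v i) ≤ + t * ∑ (λ x → ∑ λ y → crossing v w x y)
    step v w = begin
      ∑ (λ i → (1ℤ - δ i (c v w)) * sq v i)
        -- Cauchy-Schwarz for the indicator of class `i` of `v`, coloured by `c w`; the weight keeps
        -- only the classes without `w`.
        ≤⟨ ∑-mono (λ i → ℤₚ.*-monoˡ-≤-nonNeg (1ℤ - δ i (c v w)) {{nonNegative (ℤₚ.i≤j⇒0≤j-i ([]≤1 (i ≟ c v w)))}}
             (cauchy-schwarz-colour (c w) (λ x → δ i (c v x)))) ⟩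
      ∑ (λ i → (1ℤ - δ i (c v w)) * (+ t * ∑ λ x → ∑ λ y → δ i (c v x) * δ i (c v y) * mono w x y))
        ≡⟨ ∑-cong (λ i → regroup₁ (1ℤ - δ i (c v w)) (+ t) (∑ λ x → ∑ λ y → δ i (c v x) * δ i (c v y) * mono w x y)) ⟩
      ∑ (λ i → + t * ((1ℤ - δ i (c v w)) * ∑ λ x → ∑ λ y → δ i (c v x) * δ i (c v y) * mono w x y))
        ≡⟨ ∑-*ˡ (+ t) (λ i → (1ℤ - δ i (c v w)) * ∑ λ x → ∑ λ y → δ i (c v x) * δ i (c v y) * mono w x y) ⟩
      + t * ∑ (λ i → (1ℤ - δ i (c v w)) * ∑ λ x → ∑ λ y → δ i (c v x) * δ i (c v y) * mono w x y)
        ≡⟨ cong (+ t *_) (∑-cong (λ i → trans (sym (∑-*ˡ (1ℤ - δ i (c v w)) (λ x → ∑ λ y → δ i (c v x) * δ i (c v y) * mono w x y)))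
             (∑-cong (λ x → sym (∑-*ˡ (1ℤ - δ i (c v w)) (λ y → δ i (c v x) * δ i (c v y) * mono w x y)))))) ⟩
      + t * ∑ (λ i → ∑ λ x → ∑ λ y → (1ℤ - δ i (c v w)) * (δ i (c v x) * δ i (c v y) * mono w x y))
        ≡⟨ cong (+ t *_) (sym (∑-rotate₃ (λ x y i → (1ℤ - δ i (c v w)) * (δ i (c v x) * δ i (c v y) * mono w x y)))) ⟩
      + t * ∑ (λ x → ∑ λ y → ∑ λ i → (1ℤ - δ i (c v w)) * (δ i (c v x) * δ i (c v y) * mono w x y))
        ≡⟨ cong (+ t *_) (∑-cong (λ x → ∑-cong (λ y → collapse x y))) ⟩
      + t * ∑ (λ x → ∑ λ y → crossing v w x y) ∎
      where
      regroup₁ : ∀ p t s → p * (t * s) ≡ t * (p * s)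
      regroup₁ = solve-∀
      regroup₂ : ∀ p q r m → (1ℤ - p) * (q * r * m) ≡ q * (r * (1ℤ - p) * m)
      regroup₂ = solve-∀
      -- The factor `δ i (c v x)` leaves only the class `i` of `x`, where the other two factors
      -- become conditions on `y` and `w` relative to `x`.
      collapse : ∀ x y → ∑ (λ i → (1ℤ - δ i (c v w)) * (δ i (c v x) * δ i (c v y) * mono w x y)) ≡ crossing v w x y
      collapse x y = trans
        (∑-cong (λ i → trans (regroup₂ (δ i (c v w)) (δ i (c v x)) (δ i (c v y)) (mono w x y))
          (cong (_* (δ i (c v y) * (1ℤ - δ i (c v w)) * mono w x y)) (δ-sym i (c v x)))))
        (∑-δ (c v x) (λ i → δ i (c v y) * (1ℤ - δ i (c v w)) * mono w x y))

-- Convexity in the class sizes and the density of blocked triples.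

-- Up to `k = N` the cubic `(4τ + 1) N k² - k³` lies above its tangent at `k = N/τ`, with equality
-- for equal classes. The tangent values have a fixed sum because the class sizes add up to `N`.
convexity : ∀ {n t} (c : Fin n → Fin t) → 1 ℕ.≤ t →
  let k = fibre c ; N = + n ; τ = + t in
  τ * (+ 4 * τ * τ + τ - 1ℤ) * (N * N * N) ≤
  τ * τ * τ * ((+ 4 * τ + 1ℤ) * N * ∑ (λ i → k i * k i) - ∑ (λ i → k i * (k i * k i)))
convexity {n} {t} c 1≤t = ≤-by-difference (∑-nonneg nonneg) (begin
    -- Cubic minus tangent, cleared of denominators: a double root at `k = N/τ`, the last factor
    -- being fixed by the leading coefficients.
    ∑ (λ i → (τ * k i - N) * (τ * k i - N) * (A * N - τ * k i))
      ≡⟨ ∑-cong (λ i → expand τ N (k i)) ⟩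
    ∑ (λ i → (P * (k i * k i) - Q * (k i * (k i * k i))) - (R * k i - U))
      ≡⟨ ∑-sub (λ i → P * (k i * k i) - Q * (k i * (k i * k i))) (λ i → R * k i - U) ⟩
    ∑ (λ i → P * (k i * k i) - Q * (k i * (k i * k i))) - ∑ (λ i → R * k i - U)
      ≡⟨ cong₂ _-_ (trans (∑-sub (λ i → P * (k i * k i)) (λ i → Q * (k i * (k i * k i))))
                     (cong₂ _-_ (∑-*ˡ P (λ i → k i * k i)) (∑-*ˡ Q (λ i → k i * (k i * k i)))))
                   (trans (∑-sub (λ i → R * k i) (λ _ → U))
                     (cong₂ _-_ (trans (∑-*ˡ R k) (cong (R *_) (∑-fibre-sizes c))) (∑-const t U))) ⟩
    (P * S₂ - Q * S₃) - (R * N - τ * U)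
      ≡⟨ collect τ N S₂ S₃ ⟩
    τ * τ * τ * ((+ 4 * τ + 1ℤ) * N * S₂ - S₃) - τ * (+ 4 * τ * τ + τ - 1ℤ) * (N * N * N) ∎)
  where
  open ≡-Reasoning
  k = fibre c
  N τ A P Q R U S₂ S₃ : ℤ
  N = + n
  τ = + t
  A = + 4 * τ * τ + τ - + 2
  P = τ * τ * τ * ((+ 4 * τ + 1ℤ) * N)
  Q = τ * τ * τ
  R = τ * (+ 8 * τ * τ + + 2 * τ - + 3) * N * N
  U = (+ 4 * τ * τ + τ - + 2) * (N * N * N)
  S₂ = ∑ (λ i → k i * k i)
  S₃ = ∑ (λ i → k i * (k i * k i))
  expand : ∀ τ N k → (τ * k - N) * (τ * k - N) * ((+ 4 * τ * τ + τ - + 2) * N - τ * k) ≡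
    (τ * τ * τ * ((+ 4 * τ + 1ℤ) * N) * (k * k) - τ * τ * τ * (k * (k * k))) -
    (τ * (+ 8 * τ * τ + + 2 * τ - + 3) * N * N * k - (+ 4 * τ * τ + τ - + 2) * (N * N * N))
  expand = solve-∀
  collect : ∀ τ N S₂ S₃ →
    (τ * τ * τ * ((+ 4 * τ + 1ℤ) * N) * S₂ - τ * τ * τ * S₃) -
    (τ * (+ 8 * τ * τ + + 2 * τ - + 3) * N * N * N - τ * ((+ 4 * τ * τ + τ - + 2) * (N * N * N))) ≡
    τ * τ * τ * ((+ 4 * τ + 1ℤ) * N * S₂ - S₃) - τ * (+ 4 * τ * τ + τ - 1ℤ) * (N * N * N)
  collect = solve-∀
  0≤τ-1 : 0ℤ ≤ τ - 1ℤ
  0≤τ-1 = ℤₚ.i≤j⇒0≤j-i (+≤+ 1≤t)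
  -- Shows the last factor to be nonnegative when `τ` is at least 1 and `k` at most `N`.
  slack : ∀ τ N k → (+ 4 * τ * (τ - 1ℤ) + + 4 * (τ - 1ℤ) + + 2) * N + τ * (N - k) ≡ (+ 4 * τ * τ + τ - + 2) * N - τ * k
  slack = solve-∀
  nonneg : ∀ i → 0ℤ ≤ (τ * k i - N) * (τ * k i - N) * (A * N - τ * k i)
  nonneg i = 0≤* (0≤square (τ * k i - N)) (subst (0ℤ ≤_) (slack τ N (k i))
    (0≤+ (0≤* (0≤+ (0≤+ (0≤* {+ 4 * τ} (0≤* {+ 4} {τ} 0≤+n 0≤+n) 0≤τ-1) (0≤* {+ 4} 0≤+n 0≤τ-1)) (0≤+n {2})) (0≤+n {n}))
         (0≤* (0≤+n {t}) (ℤₚ.i≤j⇒0≤j-i (fibre≤ c i)))))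

module _ {n t : ℕ} .{{_ : ℕ.NonZero n}} .{{_ : ℕ.NonZero t}} (2≤t : 2 ℕ.≤ t) (c : Fin n → Fin n → Fin t) where
  open Colourings c
  private
    N τ : ℤ
    N = + n
    τ = + t

  summed-convexity : N * (τ * (+ 4 * τ * τ + τ - 1ℤ) * (N * N * N)) ≤ τ * τ * τ * ((+ 4 * τ + 1ℤ) * N * #mono - ∑k³)
  summed-convexity = begin
    N * (τ * (+ 4 * τ * τ + τ - 1ℤ) * (N * N * N))
      ≡⟨ sym (∑-const n (τ * (+ 4 * τ * τ + τ - 1ℤ) * (N * N * N))) ⟩
    ∑ {n} (λ v → τ * (+ 4 * τ * τ + τ - 1ℤ) * (N * N * N))
      ≤⟨ ∑-mono (λ v → convexity (c v) (ℕₚ.≤-trans (ℕ.s≤s z≤n) 2≤t)) ⟩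
    ∑ (λ v → τ * τ * τ * ((+ 4 * τ + 1ℤ) * N * S₂ v - S₃ v))
      ≡⟨ ∑-*ˡ (τ * τ * τ) (λ v → (+ 4 * τ + 1ℤ) * N * S₂ v - S₃ v) ⟩
    τ * τ * τ * ∑ (λ v → (+ 4 * τ + 1ℤ) * N * S₂ v - S₃ v)
      ≡⟨ cong (τ * τ * τ *_) (trans (∑-sub (λ v → (+ 4 * τ + 1ℤ) * N * S₂ v) S₃) (cong (_- ∑k³) (trans (∑-*ˡ ((+ 4 * τ + 1ℤ) * N) S₂) (cong ((+ 4 * τ + 1ℤ) * N *_) (sym #mono≡∑k²))))) ⟩
    τ * τ * τ * ((+ 4 * τ + 1ℤ) * N * #mono - ∑k³) ∎
    where
    open ℤₚ.≤-Reasoning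
    S₂ S₃ : Fin n → ℤ
    S₂ v = ∑ (λ i → fibre (c v) i * fibre (c v) i)
    S₃ v = ∑ (λ i → fibre (c v) i * (fibre (c v) i * fibre (c v) i))

  -- As `#excess` is `#blocked - #mono`, the two crossing bounds combine to
  -- `(4τ + 1) N #mono - ∑k³ ≤ 4τ N #blocked`. This explains the coefficient in `convexity`, which
  -- bounds the left side from below.
  many-blocked : (+ 8 * τ + 1ℤ) * (N * N * N) ≤ + 8 * τ * τ * #blocked
  many-blocked = cancel (≤-by-difference
    -- Twice `summed-convexity`, `2τ³` times `crossing-lower` and `2τ⁴` times `crossing-upper`: all
    -- of `#mono`, `∑k³` and `∑⁴ crossing` cancel. The final term, nonnegative by `2≤t`, lowers the
    -- gain `(τ - 1)/(4τ³)` to `1/(8τ²)`. The sum is `τ²N` times the claimed difference.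
    (0≤+ (0≤+ (0≤* (0≤+n {2}) (ℤₚ.i≤j⇒0≤j-i summed-convexity))
              (0≤* (0≤* (0≤+n {2}) (0≤* (0≤* (0≤+n {t}) (0≤+n {t})) (0≤+n {t}))) (0≤+ (ℤₚ.i≤j⇒0≤j-i crossing-lower)
                 (0≤* (0≤+n {t}) (ℤₚ.i≤j⇒0≤j-i crossing-upper)))))
         (0≤* (0≤* (0≤* (0≤+n {t}) (0≤+n {n})) (ℤₚ.i≤j⇒0≤j-i (+≤+ 2≤t))) (0≤* (0≤* (0≤+n {n}) (0≤+n {n})) (0≤+n {n}))))
    (trans (cong (λ e → + 2 * (τ * τ * τ * ((+ 4 * τ + 1ℤ) * N * #mono - ∑k³) - N * (τ * (+ 4 * τ * τ + τ - 1ℤ) * (N * N * N)))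
        + + 2 * (τ * τ * τ) * ((τ * ∑⁴ crossing - (N * #mono - ∑k³)) + τ * (+ 4 * N * e - ∑⁴ crossing))
        + τ * N * (τ - + 2) * (N * N * N)) #excess≡)
      (identity τ N #mono ∑k³ #blocked (∑⁴ crossing))))
    where
    identity : ∀ τ N M K B X →
      + 2 * (τ * τ * τ * ((+ 4 * τ + 1ℤ) * N * M - K) - N * (τ * (+ 4 * τ * τ + τ - 1ℤ) * (N * N * N)))
        + + 2 * (τ * τ * τ) * ((τ * X - (N * M - K)) + τ * (+ 4 * N * (B - M) - X))
        + τ * N * (τ - + 2) * (N * N * N)
      ≡ (τ * τ * N) * (+ 8 * τ * τ * B) - (τ * τ * N) * ((+ 8 * τ + 1ℤ) * (N * N * N))
    identity = solve-∀
    cancel : (τ * τ * N) * ((+ 8 * τ + 1ℤ) * (N * N * N)) ≤ (τ * τ * N) * (+ 8 * τ * τ * #blocked) →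
             (+ 8 * τ + 1ℤ) * (N * N * N) ≤ + 8 * τ * τ * #blocked
    cancel = go {n} {t}
      where
      go : ∀ {n t} .{{_ : ℕ.NonZero n}} .{{_ : ℕ.NonZero t}} {i j} → (+ t * + t * + n) * i ≤ (+ t * + t * + n) * j → i ≤ j
      go {suc n} {suc t} {i} {j} = ℤₚ.*-cancelˡ-≤-pos i j (+ suc t * + suc t * + suc n)

-- Increasing triples among all ordered triples.

∑³ : ∀ {n} → (Fin n → Fin n → Fin n → ℤ) → ℤ
∑³ f = ∑ λ x → ∑ λ y → ∑ λ z → f x y z

∑³-cong : ∀ {n} {f g : Fin n → Fin n → Fin n → ℤ} → (∀ x y z → f x y z ≡ g x y z) → ∑³ f ≡ ∑³ g
∑³-cong f≡g = ∑-cong λ x → ∑-cong λ y → ∑-cong λ z → f≡g x y z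

∑³-mono : ∀ {n} {f g : Fin n → Fin n → Fin n → ℤ} → (∀ x y z → f x y z ≤ g x y z) → ∑³ f ≤ ∑³ g
∑³-mono f≤g = ∑-mono λ x → ∑-mono λ y → ∑-mono λ z → f≤g x y z

∑³-+ : ∀ {n} (f g : Fin n → Fin n → Fin n → ℤ) → ∑³ (λ x y z → f x y z + g x y z) ≡ ∑³ f + ∑³ g
∑³-+ f g = trans (∑-cong (λ x → trans (∑-cong (λ y → ∑-distrib-+ (f x y) (g x y)))
  (∑-distrib-+ (λ y → ∑ (f x y)) (λ y → ∑ (g x y)))))
  (∑-distrib-+ (λ x → ∑ λ y → ∑ (f x y)) (λ x → ∑ λ y → ∑ (g x y)))

lt : ∀ {n} → Fin n → Fin n → ℤ
lt x y = [ x Fin.<? y ]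

0≤lt : ∀ {n} (x y : Fin n) → 0ℤ ≤ lt x y
0≤lt x y = 0≤[] (x Fin.<? y)

lt-antisym : ∀ {n} (x y : Fin n) → lt x y + lt y x ≤ 1ℤ
lt-antisym x y = go (x Fin.<? y) (y Fin.<? x)
  where
  go : (p : Dec (x Fin.< y)) (q : Dec (y Fin.< x)) → [ p ] + [ q ] ≤ 1ℤ
  go (yes x<y) (yes y<x) = ⊥-elim (ℕₚ.<-asym x<y y<x)
  go (yes _)   (no _)    = ℤₚ.≤-refl
  go (no _)    q         = subst (_≤ 1ℤ) (sym (ℤₚ.+-identityˡ [ q ])) ([]≤1 q)

-- All three pairs appear, so that each ordering of the vertices is one term in the expansion of a
-- product over the pairs.
ordered : ∀ {n} → Fin n → Fin n → Fin n → ℤ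
ordered x y z = lt x y * lt y z * lt x z

-- The six products are among the eight terms of (lt x y + lt y x) (lt y z + lt z y) (lt x z + lt z x) ≤ 1.
ordered-perms≤1 : ∀ {n} (x y z : Fin n) →
  ordered x y z + ordered x z y + ordered y x z + ordered y z x + ordered z x y + ordered z y x ≤ 1ℤ
ordered-perms≤1 x y z = ≤-by-difference
  (0≤+ (0≤+ (0≤+ (ℤₚ.i≤j⇒0≤j-i xy) (0≤* (0≤pair x y) (ℤₚ.i≤j⇒0≤j-i yz))) (0≤* (0≤* (0≤pair x y) (0≤pair y z)) (ℤₚ.i≤j⇒0≤j-i xz)))
       (0≤+ (0≤* (0≤* (0≤lt x y) (0≤lt y z)) (0≤lt z x)) (0≤* (0≤* (0≤lt y x) (0≤lt z y)) (0≤lt x z))))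
  (identity (lt x y) (lt y x) (lt y z) (lt z y) (lt x z) (lt z x))
  where
  xy = lt-antisym x y
  yz = lt-antisym y z
  xz = lt-antisym x z
  0≤pair : ∀ x y → 0ℤ ≤ lt x y + lt y x
  0≤pair x y = 0≤+ (0≤lt x y) (0≤lt y x)
  identity : ∀ u u′ v v′ w w′ →
    ((1ℤ - (u + u′)) + (u + u′) * (1ℤ - (v + v′)) + (u + u′) * (v + v′) * (1ℤ - (w + w′))) + (u * v * w′ + u′ * v′ * w)
    ≡ 1ℤ - (u * v * w + w * v′ * u + u′ * w * v + v * w′ * u′ + w′ * u * v′ + v′ * u′ * w′)
  identity = solve-∀

-- By symmetry of `f`, permuting the summation variables turns six copies of the sum into one for
-- each ordering, and at most one ordering of a given triple is increasing.
ordered-sixth : ∀ {n} (f : Fin n → Fin n → Fin n → ℤ) → (∀ x y z → 0ℤ ≤ f x y z) →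
  (∀ x y z → f y x z ≡ f x y z) → (∀ x y z → f x z y ≡ f x y z) →
  + 6 * ∑³ (λ x y z → f x y z * ordered x y z) ≤ ∑³ f
ordered-sixth {n} f 0≤f swap₁₂ swap₂₃ = begin
  + 6 * ∑³ g
    ≡⟨ six (∑³ g) ⟩
  ∑³ g + ∑³ g + ∑³ g + ∑³ g + ∑³ g + ∑³ g
    ≡⟨ cong₂ _+_ (cong₂ _+_ (cong₂ _+_ (cong₂ _+_ (cong₂ _+_ (refl {x = ∑³ g})
         (trans (∑-cong (λ x → ∑-comm (g x))) (∑³-cong (λ x y z → cong (_* ordered x z y) (swap₂₃ x y z)))))
         (trans (∑-comm (λ x y → ∑ (g x y))) (∑³-cong (λ x y z → cong (_* ordered y x z) (swap₁₂ x y z)))))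
         (trans (∑-rotate₃ g) (∑³-cong (λ x y z → cong (_* ordered y z x) (rot x y z)))))
         (trans (sym (∑-rotate₃ (λ x y z → g z x y))) (∑³-cong (λ x y z → cong (_* ordered z x y) (rot′ x y z)))))
         (trans (∑-reverse₃ g) (∑³-cong (λ x y z → cong (_* ordered z y x) (trans (swap₁₂ y z x) (rot x y z))))) ⟩
  ∑³ (h ordered) + ∑³ (h o₂) + ∑³ (h o₃) + ∑³ (h o₄) + ∑³ (h o₅) + ∑³ (h o₆)
    ≡⟨ sym (trans (∑³-+ (λ x y z → h ordered x y z + h o₂ x y z + h o₃ x y z + h o₄ x y z + h o₅ x y z) (h o₆))
       (cong (_+ ∑³ (h o₆)) (trans (∑³-+ (λ x y z → h ordered x y z + h o₂ x y z + h o₃ x y z + h o₄ x y z) (h o₅))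
       (cong (_+ ∑³ (h o₅)) (trans (∑³-+ (λ x y z → h ordered x y z + h o₂ x y z + h o₃ x y z) (h o₄))
       (cong (_+ ∑³ (h o₄)) (trans (∑³-+ (λ x y z → h ordered x y z + h o₂ x y z) (h o₃))
       (cong (_+ ∑³ (h o₃)) (∑³-+ (h ordered) (h o₂)))))))))) ⟩
  ∑³ (λ x y z → h ordered x y z + h o₂ x y z + h o₃ x y z + h o₄ x y z + h o₅ x y z + h o₆ x y z)
    ≤⟨ ∑³-mono (λ x y z → ≤-by-difference (0≤* (0≤f x y z) (ℤₚ.i≤j⇒0≤j-i (ordered-perms≤1 x y z)))
         (factor (f x y z) (ordered x y z) (o₂ x y z) (o₃ x y z) (o₄ x y z) (o₅ x y z) (o₆ x y z))) ⟩
  ∑³ f ∎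
  where
  open ℤₚ.≤-Reasoning
  g o₂ o₃ o₄ o₅ o₆ : Fin n → Fin n → Fin n → ℤ
  g x y z = f x y z * ordered x y z
  o₂ x y z = ordered x z y
  o₃ x y z = ordered y x z
  o₄ x y z = ordered y z x
  o₅ x y z = ordered z x y
  o₆ x y z = ordered z y x
  h : (Fin n → Fin n → Fin n → ℤ) → Fin n → Fin n → Fin n → ℤ
  h o x y z = f x y z * o x y z
  rot : ∀ x y z → f y z x ≡ f x y z
  rot x y z = trans (swap₂₃ y x z) (swap₁₂ x y z)
  rot′ : ∀ x y z → f z x y ≡ f x y z
  rot′ x y z = trans (swap₁₂ x z y) (swap₂₃ x y z)
  six : ∀ s → + 6 * s ≡ s + s + s + s + s + s
  six = solve-∀
  factor : ∀ f a b c d e k → f * (1ℤ - (a + b + c + d + e + k)) ≡ f - (f * a + f * b + f * c + f * d + f * e + f * k)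
  factor = solve-∀

-- Edge lists as weights on triples.

δ³ : ∀ {n} → Triple n → Fin n → Fin n → Fin n → ℤ
δ³ (a , b , c) x y z = δ a x * (δ b y * δ c z)

∑³-δ³ : ∀ {n} (e : Triple n) → ∑³ (δ³ e) ≡ 1ℤ
∑³-δ³ (a , b , c) = begin
  ∑³ (δ³ (a , b , c))
    ≡⟨ ∑-cong (λ x → trans (∑-cong (λ y → ∑-*ˡ (δ a x) (λ z → δ b y * δ c z))) (∑-*ˡ (δ a x) (λ y → ∑ λ z → δ b y * δ c z))) ⟩
  ∑ (λ x → δ a x * ∑ λ y → ∑ λ z → δ b y * δ c z)
    ≡⟨ ∑-δ a (λ _ → ∑ λ y → ∑ λ z → δ b y * δ c z) ⟩
  ∑ (λ y → ∑ λ z → δ b y * δ c z)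
    ≡⟨ ∑-product (δ b) (δ c) ⟩
  ∑ (δ b) * ∑ (δ c)
    ≡⟨ cong₂ _*_ (∑-δ-1 b) (∑-δ-1 c) ⟩
  1ℤ ∎
  where
  open ≡-Reasoning
  ∑-δ-1 : ∀ {n} (x : Fin n) → ∑ (δ x) ≡ 1ℤ
  ∑-δ-1 x = trans (∑-cong (λ i → sym (ℤₚ.*-identityʳ (δ x i)))) (∑-δ x (λ _ → 1ℤ))

δ³-≢ : ∀ {n} (e : Triple n) x y z → (x , y , z) ≢ e → δ³ e x y z ≡ 0ℤ
δ³-≢ (a , b , c) x y z ne = go (a ≟ x) (b ≟ y) (c ≟ z)
  where
  go : (p : Dec (a ≡ x)) (q : Dec (b ≡ y)) (r : Dec (c ≡ z)) → [ p ] * ([ q ] * [ r ]) ≡ 0ℤ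
  go (yes refl) (yes refl) (yes refl) = ⊥-elim (ne refl)
  go (no _)     q          r          = ℤₚ.*-zeroˡ ([ q ] * [ r ])
  go (yes _)    (no _)     r          = cong (1ℤ *_) (ℤₚ.*-zeroˡ [ r ])
  go (yes _)    (yes _)    (no _)     = refl

δ³≤1 : ∀ {n} (e : Triple n) x y z → δ³ e x y z ≤ 1ℤ
δ³≤1 (a , b , c) x y z = go (a ≟ x) (b ≟ y) (c ≟ z)
  where
  go : (p : Dec (a ≡ x)) (q : Dec (b ≡ y)) (r : Dec (c ≡ z)) → [ p ] * ([ q ] * [ r ]) ≤ 1ℤ
  go (yes _) (yes _) (yes _) = ℤₚ.≤-refl
  go (yes _) (yes _) (no _)  = +≤+ z≤n
  go (yes _) (no _)  (yes _) = +≤+ z≤n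
  go (yes _) (no _)  (no _)  = +≤+ z≤n
  go (no _)  (yes _) (yes _) = +≤+ z≤n
  go (no _)  (yes _) (no _)  = +≤+ z≤n
  go (no _)  (no _)  (yes _) = +≤+ z≤n
  go (no _)  (no _)  (no _)  = +≤+ z≤n

-- Weighting triples by multiplicity turns the length of a list into a sum over all triples, which
-- can be compared termwise.
occurrences : ∀ {n} → List (Triple n) → Fin n → Fin n → Fin n → ℤ
occurrences []       x y z = 0ℤ
occurrences (e ∷ es) x y z = δ³ e x y z + occurrences es x y z

∑³-occurrences : ∀ {n} (es : List (Triple n)) → ∑³ (occurrences es) ≡ + length es
∑³-occurrences {n} [] = trans (∑-cong {n} (λ _ → trans (∑-cong {n} (λ _ → zeros)) zeros)) zeros
  where
  zeros : ∑ {n} (λ _ → 0ℤ) ≡ 0ℤ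
  zeros = trans (∑-const n 0ℤ) (ℤₚ.*-zeroʳ (+ n))
∑³-occurrences (e ∷ es) = trans (∑³-+ (δ³ e) (occurrences es)) (cong₂ _+_ (∑³-δ³ e) (∑³-occurrences es))

occurrences-∉ : ∀ {n} (es : List (Triple n)) x y z → All ((x , y , z) ≢_) es → occurrences es x y z ≡ 0ℤ
occurrences-∉ []       x y z []         = refl
occurrences-∉ (e ∷ es) x y z (ne ∷ nes) = cong₂ _+_ (δ³-≢ e x y z ne) (occurrences-∉ es x y z nes)

-- In a duplicate-free list the multiplicity is 1 on the list, where `g` is 1, and 0 elsewhere,
-- where `g` is nonnegative.
occurrences-unique : ∀ {n} {es : List (Triple n)} → Unique es → (g : Fin n → Fin n → Fin n → ℤ) → (∀ x y z → 0ℤ ≤ g x y z) →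
  All (λ e → g (proj₁ e) (proj₁ (proj₂ e)) (proj₂ (proj₂ e)) ≡ 1ℤ) es → ∀ x y z → occurrences es x y z ≤ g x y z
occurrences-unique [] g 0≤g [] x y z = 0≤g x y z
occurrences-unique {es = e ∷ es} (e∉es ∷ unique) g 0≤g (ge≡1 ∷ g≡1) x y z with ≡-dec _≟_ (≡-dec _≟_ _≟_) (x , y , z) e
... | yes refl = begin
  δ³ e x y z + occurrences es x y z  ≡⟨ cong (λ o → δ³ e x y z + o) (occurrences-∉ es x y z e∉es) ⟩
  δ³ e x y z + 0ℤ                    ≡⟨ ℤₚ.+-identityʳ (δ³ e x y z) ⟩
  δ³ e x y z                         ≤⟨ δ³≤1 e x y z ⟩
  1ℤ                                 ≡⟨ sym ge≡1 ⟩
  g x y z                            ∎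
  where open ℤₚ.≤-Reasoning
... | no ne = begin
  δ³ e x y z + occurrences es x y z  ≡⟨ cong (_+ occurrences es x y z) (δ³-≢ e x y z ne) ⟩
  0ℤ + occurrences es x y z          ≡⟨ ℤₚ.+-identityˡ (occurrences es x y z) ⟩
  occurrences es x y z               ≤⟨ occurrences-unique unique g 0≤g g≡1 x y z ⟩
  g x y z                            ∎
  where open ℤₚ.≤-Reasoning

-- Edges against blocked triples.

module _ {n t : ℕ} (H : ThreeGraph n) (links : AllLinksChromaticAtMost t H) where

  colour : Fin n → Fin n → Fin t
  colour v = proj₁ (links v)

  open Colourings colour

  free : Fin n → Fin n → Fin n → ℤ
  free x y z = 1ℤ - blocked x y z

  private
    0≤free : ∀ x y z → 0ℤ ≤ free x y z
    0≤free x y z = ℤₚ.i≤j⇒0≤j-i ([]≤1 (blocked? x y z))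

    []-cong : ∀ {P Q : Set} (P? : Dec P) (Q? : Dec Q) → (P → Q) → (Q → P) → [ P? ] ≡ [ Q? ]
    []-cong (yes p) Q? f g = sym ([]≡1 Q? (f p))
    []-cong (no ¬p) Q? f g = sym ([]≡0 Q? (λ q → ¬p (g q)))

    Blocked-swap₁₂ : ∀ {x y z} → Blocked x y z → Blocked y x z
    Blocked-swap₁₂ (inj₁ p)        = inj₂ (inj₁ p)
    Blocked-swap₁₂ (inj₂ (inj₁ p)) = inj₁ p
    Blocked-swap₁₂ (inj₂ (inj₂ p)) = inj₂ (inj₂ (sym p))

    Blocked-swap₂₃ : ∀ {x y z} → Blocked x y z → Blocked x z y
    Blocked-swap₂₃ (inj₁ p)        = inj₁ (sym p)
    Blocked-swap₂₃ (inj₂ (inj₁ p)) = inj₂ (inj₂ p)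
    Blocked-swap₂₃ (inj₂ (inj₂ p)) = inj₂ (inj₁ p)

    -- From each of its vertices an edge appears as a link edge between the other two, which the
    -- proper colouring there separates.
    edge-free : ∀ {x y z} → (x , y , z) ∈ edges H → x Fin.< y → y Fin.< z → ¬ Blocked x y z
    edge-free {x} {y} {z} e∈H x<y y<z = λ
      { (inj₁ p)        → proj₂ (links x) y z (x≢y , x≢z , y≢z , e , e∈H , inj₁ refl , inj₂ (inj₁ refl) , inj₂ (inj₂ refl)) p
      ; (inj₂ (inj₁ p)) → proj₂ (links y) x z ((λ q → x≢y (sym q)) , y≢z , x≢z , e , e∈H , inj₂ (inj₁ refl) , inj₁ refl , inj₂ (inj₂ refl)) p
      ; (inj₂ (inj₂ p)) → proj₂ (links z) x y ((λ q → x≢z (sym q)) , (λ q → y≢z (sym q)) , x≢y , e , e∈H , inj₂ (inj₂ refl) , inj₁ refl , inj₂ (inj₁ refl)) p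
      }
      where
      e = x , y , z
      x≢y : x ≢ y
      x≢y = Finₚ.<⇒≢ x<y
      y≢z : y ≢ z
      y≢z = Finₚ.<⇒≢ y<z
      x≢z : x ≢ z
      x≢z = Finₚ.<⇒≢ (Finₚ.<-trans x<y y<z)

    edge-weight : ∀ {x y z} → (x , y , z) ∈ edges H → free x y z * ordered x y z ≡ 1ℤ
    edge-weight {x} {y} {z} e∈H with All.lookup (increasing H) e∈H
    ... | x<y , y<z = cong₂ _*_ (cong (λ b → 1ℤ - b) ([]≡0 (blocked? x y z) (edge-free e∈H x<y y<z)))
      (cong₂ _*_ (cong₂ _*_ ([]≡1 (x Fin.<? y) x<y) ([]≡1 (y Fin.<? z) y<z)) ([]≡1 (x Fin.<? z) (Finₚ.<-trans x<y y<z)))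

  -- Edges are increasing triples that are not blocked. Being blocked is invariant under
  -- permutations, so at most a sixth of the unblocked ordered triples are increasing.
  size+blocked : + 6 * + size H + #blocked ≤ + n * + n * + n
  size+blocked = ≤-by-difference (ℤₚ.i≤j⇒0≤j-i six-size) (trans (cong (_- + 6 * + size H) ∑-free) (rearrange (+ n) #blocked (+ size H)))
    where
    rearrange : ∀ n b s → (n * (n * (n * 1ℤ)) - b) - + 6 * s ≡ n * n * n - (+ 6 * s + b)
    rearrange = solve-∀
    ∑-free : ∑³ free ≡ + n * (+ n * (+ n * 1ℤ)) - #blocked
    ∑-free = trans (∑-cong (λ x → trans (∑-cong (λ y → trans (∑-sub (λ _ → 1ℤ) (blocked x y)) (cong (_- ∑ (blocked x y)) (∑-const n 1ℤ))))
      (trans (∑-sub (λ _ → + n * 1ℤ) (λ y → ∑ (blocked x y))) (cong (_- (∑ λ y → ∑ (blocked x y))) (∑-const n (+ n * 1ℤ))))))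
      (trans (∑-sub (λ _ → + n * (+ n * 1ℤ)) (λ x → ∑ λ y → ∑ (blocked x y))) (cong (_- #blocked) (∑-const n (+ n * (+ n * 1ℤ)))))
    six-size : + 6 * + size H ≤ ∑³ free
    six-size = begin
      + 6 * + size H
        ≡⟨ cong (+ 6 *_) (sym (∑³-occurrences (edges H))) ⟩
      + 6 * ∑³ (occurrences (edges H))
        ≤⟨ ℤₚ.*-monoˡ-≤-nonNeg (+ 6) (∑³-mono (occurrences-unique (distinct H) (λ x y z → free x y z * ordered x y z)
             (λ x y z → 0≤* (0≤free x y z) (0≤* (0≤* (0≤lt x y) (0≤lt y z)) (0≤lt x z)))
             (All.tabulate edge-weight))) ⟩
      + 6 * ∑³ (λ x y z → free x y z * ordered x y z)
        ≤⟨ ordered-sixth free 0≤free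
             (λ x y z → cong (λ b → 1ℤ - b) ([]-cong (blocked? y x z) (blocked? x y z) Blocked-swap₁₂ Blocked-swap₁₂))
             (λ x y z → cong (λ b → 1ℤ - b) ([]-cong (blocked? x z y) (blocked? x y z) Blocked-swap₂₃ Blocked-swap₂₃)) ⟩
      ∑³ free ∎
      where open ℤₚ.≤-Reasoning

-- Binomial coefficients and the bound for finite `n`.

-- Pascal's rule, stated over the integers so that neither division nor truncated subtraction
-- occurs.
2*nC2 : ∀ n → + 2 * + (n C 2) ≡ + n * (+ n - 1ℤ)
2*nC2 zero    = refl
2*nC2 (suc n) = begin
  + 2 * + (suc n C 2)            ≡⟨ cong (λ k → + 2 * + k) (sym (nCk+nC[k+1]≡[n+1]C[k+1] n 1)) ⟩
  + 2 * + (n C 1 ℕ.+ n C 2)      ≡⟨ cong (+ 2 *_) (ℤₚ.pos-+ (n C 1) (n C 2)) ⟩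
  + 2 * (+ (n C 1) + + (n C 2))  ≡⟨ ℤₚ.*-distribˡ-+ (+ 2) (+ (n C 1)) (+ (n C 2)) ⟩
  + 2 * + (n C 1) + + 2 * + (n C 2) ≡⟨ cong₂ _+_ (cong (λ k → + 2 * + k) (nC1≡n n)) (2*nC2 n) ⟩
  + 2 * + n + + n * (+ n - 1ℤ)   ≡⟨ arith (+ n) ⟩
  (1ℤ + + n) * ((1ℤ + + n) - 1ℤ) ∎
  where
  open ≡-Reasoning
  arith : ∀ n → + 2 * n + n * (n - 1ℤ) ≡ (1ℤ + n) * ((1ℤ + n) - 1ℤ)
  arith = solve-∀

6*nC3 : ∀ n → + 6 * + (n C 3) ≡ + n * (+ n - 1ℤ) * (+ n - + 2)
6*nC3 zero    = refl
6*nC3 (suc n) = begin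
  + 6 * + (suc n C 3)            ≡⟨ cong (λ k → + 6 * + k) (sym (nCk+nC[k+1]≡[n+1]C[k+1] n 2)) ⟩
  + 6 * + (n C 2 ℕ.+ n C 3)      ≡⟨ cong (+ 6 *_) (ℤₚ.pos-+ (n C 2) (n C 3)) ⟩
  + 6 * (+ (n C 2) + + (n C 3))  ≡⟨ split (+ (n C 2)) (+ (n C 3)) ⟩
  + 3 * (+ 2 * + (n C 2)) + + 6 * + (n C 3) ≡⟨ cong₂ _+_ (cong (+ 3 *_) (2*nC2 n)) (6*nC3 n) ⟩
  + 3 * (+ n * (+ n - 1ℤ)) + + n * (+ n - 1ℤ) * (+ n - + 2)   ≡⟨ arith (+ n) ⟩
  (1ℤ + + n) * ((1ℤ + + n) - 1ℤ) * ((1ℤ + + n) - + 2) ∎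
  where
  open ≡-Reasoning
  split : ∀ a b → + 6 * (a + b) ≡ + 3 * (+ 2 * a) + + 6 * b
  split = solve-∀
  arith : ∀ n → + 3 * (n * (n - 1ℤ)) + n * (n - 1ℤ) * (n - + 2) ≡ (1ℤ + n) * ((1ℤ + n) - 1ℤ) * ((1ℤ + n) - + 2)
  arith = solve-∀

-- Once n ≥ 72t², the surplus 1/(8t²) − 1/(12t²) pays for replacing n³ by 6 (n C 3).
size-bound : ∀ {n t} → .{{_ : ℕ.NonZero t}} → 2 ℕ.≤ t → 72 ℕ.* (t ℕ.* t) ℕ.≤ n → (H : ThreeGraph n) → AllLinksChromaticAtMost t H →
  + size H * (+ 12 * + t * + t) ≤ (+ 12 * + t * + t - + 12 * + t - 1ℤ) * + (n C 3)
size-bound {n} {t} 2≤t N≤n H links = ℤₚ.*-cancelˡ-≤-pos _ _ (+ 12) (≤-by-difference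
  -- The multipliers `24τ²` and 3 make `#blocked` cancel between the upper and the lower bound.
  (0≤+ (0≤+ (0≤* (0≤* (0≤* (0≤+n {24}) (0≤+n {t})) (0≤+n {t})) (ℤₚ.i≤j⇒0≤j-i (size+blocked H links)))
            (0≤* (0≤+n {3}) (ℤₚ.i≤j⇒0≤j-i (many-blocked {{ℕ.>-nonZero 0<n}} 2≤t (colour H links)))))
       (0≤+ (0≤+ (0≤* (0≤* (0≤+n {n}) (0≤+n {n})) 0≤N-72ττ)
                 (0≤* (0≤+ (0≤* (0≤+n {72}) (0≤+n {t})) (0≤+n {6})) (0≤* (0≤+n {n}) (0≤+n {n}))))
            (0≤* (0≤* (0≤+n {2}) (0≤+n {n}))
                 (0≤+ (0≤+ (0≤* (0≤* (0≤+n {24}) (0≤+n {t})) 0≤τ-2) (0≤* (0≤+n {24}) 0≤τ-2)) (0≤+n {46})))))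
  (trans (identity τ N (+ size H) #blocked)
    (trans (cong (λ s → + 2 * (+ 12 * τ * τ - + 12 * τ - 1ℤ) * s - + 12 * (+ size H * (+ 12 * τ * τ))) (sym (6*nC3 n)))
      (cong (_- + 12 * (+ size H * (+ 12 * τ * τ))) (regroup (+ 12 * τ * τ - + 12 * τ - 1ℤ) (+ (n C 3)))))))
  where
  open Colourings (colour H links)
  τ N : ℤ
  τ = + t
  N = + n
  0<n : 0 ℕ.< n
  0<n = ℕₚ.<-≤-trans (ℕₚ.*-mono-≤ {1} {72} (ℕ.s≤s z≤n) (ℕₚ.*-mono-≤ {1} {t} {1} {t} 1≤t 1≤t)) N≤n
    where 1≤t = ℕₚ.≤-trans (ℕ.s≤s z≤n) 2≤t
  0≤τ-2 : 0ℤ ≤ τ - + 2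
  0≤τ-2 = ℤₚ.i≤j⇒0≤j-i (+≤+ 2≤t)
  0≤N-72ττ : 0ℤ ≤ N - + 72 * (τ * τ)
  0≤N-72ττ = ℤₚ.i≤j⇒0≤j-i (subst (_≤ N) (trans (ℤₚ.pos-* 72 (t ℕ.* t)) (cong (+ 72 *_) (ℤₚ.pos-* t t))) (+≤+ N≤n))
  identity : ∀ τ N s B →
    (+ 24 * τ * τ * (N * N * N - (+ 6 * s + B)) + + 3 * (+ 8 * τ * τ * B - (+ 8 * τ + 1ℤ) * (N * N * N)))
      + ((N * N * (N - + 72 * (τ * τ)) + (+ 72 * τ + + 6) * (N * N)) + + 2 * N * ((+ 24 * τ * (τ - + 2) + + 24 * (τ - + 2)) + + 46))
    ≡ + 2 * (+ 12 * τ * τ - + 12 * τ - 1ℤ) * (N * (N - 1ℤ) * (N - + 2)) - + 12 * (s * (+ 12 * τ * τ))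
  identity = solve-∀
  regroup : ∀ a b → + 2 * a * (+ 6 * b) ≡ + 12 * (a * b)
  regroup = solve-∀

-- Passage to the rationals and the density bound.

fromℤ : ℤ → ℚ
fromℤ i = i ℚ./ 1

-- The link to unnormalised fractions, where the laws below reduce to integer arithmetic. The `0`
-- encodes denominator 1, as `mkℚᵘ` stores the denominator minus one.
toℚᵘ-fromℤ : ∀ i → ℚ.toℚᵘ (fromℤ i) ℚᵘ.≃ ℚᵘ.mkℚᵘ i 0
toℚᵘ-fromℤ i = ℚₚ.toℚᵘ-fromℚᵘ (ℚᵘ.mkℚᵘ i 0)

fromℤ-* : ∀ i j → fromℤ (i * j) ≡ fromℤ i ℚ.* fromℤ j
fromℤ-* i j = ℚₚ.toℚᵘ-injective (ℚᵘₚ.≃-trans (toℚᵘ-fromℤ (i * j)) (ℚᵘₚ.≃-sym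
  (ℚᵘₚ.≃-trans (ℚₚ.toℚᵘ-homo-* (fromℤ i) (fromℤ j)) (ℚᵘₚ.*-cong (toℚᵘ-fromℤ i) (toℚᵘ-fromℤ j)))))

fromℤ-+ : ∀ i j → fromℤ (i + j) ≡ fromℤ i ℚ.+ fromℤ j
fromℤ-+ i j = ℚₚ.toℚᵘ-injective (ℚᵘₚ.≃-trans (toℚᵘ-fromℤ (i + j)) (ℚᵘₚ.≃-sym
  (ℚᵘₚ.≃-trans (ℚₚ.toℚᵘ-homo-+ (fromℤ i) (fromℤ j)) (ℚᵘₚ.≃-trans (ℚᵘₚ.+-cong (toℚᵘ-fromℤ i) (toℚᵘ-fromℤ j))
    (ℚᵘ.*≡* (cong (_* 1ℤ) (cong₂ _+_ (ℤₚ.*-identityʳ i) (ℤₚ.*-identityʳ j))))))))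

fromℤ-neg : ∀ i → fromℤ (- i) ≡ ℚ.- fromℤ i
fromℤ-neg i = ℚₚ.toℚᵘ-injective (ℚᵘₚ.≃-trans (toℚᵘ-fromℤ (- i)) (ℚᵘₚ.≃-sym
  (ℚᵘₚ.≃-trans (ℚₚ.toℚᵘ-homo‿- (fromℤ i)) (ℚᵘₚ.-‿cong (toℚᵘ-fromℤ i)))))

fromℤ-mono : ∀ {i j} → i ≤ j → fromℤ i ℚ.≤ fromℤ j
fromℤ-mono {i} {j} i≤j = ℚₚ.toℚᵘ-cancel-≤ (ℚᵘₚ.≤-trans (ℚᵘₚ.≤-reflexive (toℚᵘ-fromℤ i))
  (ℚᵘₚ.≤-trans (ℚᵘ.*≤* (ℤₚ.*-monoʳ-≤-nonNeg 1ℤ i≤j)) (ℚᵘₚ.≤-reflexive (ℚᵘₚ.≃-sym (toℚᵘ-fromℤ j)))))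

inverse : ∀ t → .{{_ : ℕ.NonZero t}} → (+ 1 ℚ./ t) ℚ.* fromℤ (+ t) ≡ ℚ.1ℚ
inverse (suc s) = ℚₚ.toℚᵘ-injective (ℚᵘₚ.≃-trans (ℚₚ.toℚᵘ-homo-* (+ 1 ℚ./ suc s) (fromℤ (+ suc s)))
  (ℚᵘₚ.≃-trans (ℚᵘₚ.*-cong (ℚₚ.toℚᵘ-fromℚᵘ (ℚᵘ.mkℚᵘ (+ 1) s)) (toℚᵘ-fromℤ (+ suc s))) (ℚᵘ.*≡* arith)))
  where
  arith : (1ℤ * + suc s) * 1ℤ ≡ 1ℤ * + (suc s ℕ.* 1)
  arith = trans (ℤₚ.*-identityʳ (1ℤ * + suc s)) (cong (λ k → 1ℤ * + k) (sym (ℕₚ.*-identityʳ (suc s))))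

-- `12t²` is a common denominator of the three terms of `bound t`.
clear-denominators : ∀ t → .{{_ : ℕ.NonZero t}} → bound t ℚ.* fromℤ (+ 12 * + t * + t) ≡ fromℤ (+ 12 * + t * + t - + 12 * + t - 1ℤ)
clear-denominators t = begin
  bound t ℚ.* fromℤ (+ 12 * + t * + t)
    ≡⟨ cong (bound t ℚ.*_) 12tt ⟩
  bound t ℚ.* (fromℤ (+ 12) ℚ.* T ℚ.* T)
    -- An identity in independent `x` and `T`, arranged so that every `x` is paired with a `T`; then
    -- `x ℚ.* T` is replaced by 1.
    ≡⟨ expand (+ 1 ℚ./ t) T ⟩
  fromℤ (+ 12) ℚ.* T ℚ.* T ℚ.- fromℤ (+ 12) ℚ.* T ℚ.* (x ℚ.* T) ℚ.- (x ℚ.* T) ℚ.* (x ℚ.* T)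
    ≡⟨ cong (λ u → fromℤ (+ 12) ℚ.* T ℚ.* T ℚ.- fromℤ (+ 12) ℚ.* T ℚ.* u ℚ.- u ℚ.* u) (inverse t) ⟩
  fromℤ (+ 12) ℚ.* T ℚ.* T ℚ.- fromℤ (+ 12) ℚ.* T ℚ.* ℚ.1ℚ ℚ.- ℚ.1ℚ
    ≡⟨ cong (λ u → fromℤ (+ 12) ℚ.* T ℚ.* T ℚ.- u ℚ.- ℚ.1ℚ) (ℚₚ.*-identityʳ (fromℤ (+ 12) ℚ.* T)) ⟩
  fromℤ (+ 12) ℚ.* T ℚ.* T ℚ.- fromℤ (+ 12) ℚ.* T ℚ.- ℚ.1ℚ
    ≡⟨ cong (ℚ._- ℚ.1ℚ) (cong₂ ℚ._-_ (sym 12tt) (sym (fromℤ-* (+ 12) (+ t)))) ⟩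
  fromℤ (+ 12 * + t * + t) ℚ.- fromℤ (+ 12 * + t) ℚ.- ℚ.1ℚ
    ≡⟨ cong (ℚ._- ℚ.1ℚ) (sym (fromℤ-sub (+ 12 * + t * + t) (+ 12 * + t))) ⟩
  fromℤ (+ 12 * + t * + t - + 12 * + t) ℚ.- fromℤ 1ℤ
    ≡⟨ sym (fromℤ-sub (+ 12 * + t * + t - + 12 * + t) 1ℤ) ⟩
  fromℤ (+ 12 * + t * + t - + 12 * + t - 1ℤ) ∎
  where
  open ≡-Reasoning
  T x : ℚ
  T = fromℤ (+ t)
  x = + 1 ℚ./ t
  fromℤ-sub : ∀ i j → fromℤ (i - j) ≡ fromℤ i ℚ.- fromℤ j
  fromℤ-sub i j = trans (fromℤ-+ i (- j)) (cong (fromℤ i ℚ.+_) (fromℤ-neg j))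
  12tt : fromℤ (+ 12 * + t * + t) ≡ fromℤ (+ 12) ℚ.* T ℚ.* T
  12tt = trans (fromℤ-* (+ 12 * + t) (+ t)) (cong (ℚ._* T) (fromℤ-* (+ 12) (+ t)))
  expand : ∀ x T → (ℚ.1ℚ ℚ.- x ℚ.- (+ 1 ℚ./ 12) ℚ.* x ℚ.* x) ℚ.* (fromℤ (+ 12) ℚ.* T ℚ.* T) ≡
    fromℤ (+ 12) ℚ.* T ℚ.* T ℚ.- fromℤ (+ 12) ℚ.* T ℚ.* (x ℚ.* T) ℚ.- (x ℚ.* T) ℚ.* (x ℚ.* T)
  expand = solve 2 (λ x T → (con ℚ.1ℚ :- x :- con (+ 1 ℚ./ 12) :* x :* x) :* (con (fromℤ (+ 12)) :* T :* T) :=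
    con (fromℤ (+ 12)) :* T :* T :- con (fromℤ (+ 12)) :* T :* (x :* T) :- (x :* T) :* (x :* T)) refl
    where open ℚ-Solver.+-*-Solver

0≤fromℤ+ : ∀ k → ℚ.0ℚ ℚ.≤ fromℤ (+ k)
0≤fromℤ+ k = fromℤ-mono {0ℤ} {+ k} (+≤+ z≤n)

theorem1p2 : (t : ℕ) → .{{_ : NonZero t}} → 2 ℕ.≤ t → πlink≤ t (bound t)
-- From this threshold on the inequality holds with `bound t` itself, uniformly in `ε`; adding `ε`
-- then only weakens it.
theorem1p2 t 2≤t ε 0<ε = 72 ℕ.* (t ℕ.* t) , λ n N≤n H links → ℚₚ.≤-trans
  (ℚₚ.*-cancelʳ-≤-pos D {{D-positive t}} (begin
    fromℤ (+ size H) ℚ.* D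
      ≡⟨ sym (fromℤ-* (+ size H) d) ⟩
    fromℤ (+ size H * d)
      ≤⟨ fromℤ-mono (size-bound 2≤t N≤n H links) ⟩
    fromℤ (p * + (n C 3))
      ≡⟨ fromℤ-* p (+ (n C 3)) ⟩
    fromℤ p ℚ.* ℕ→ℚ (n C 3)
      ≡⟨ cong (ℚ._* ℕ→ℚ (n C 3)) (sym (clear-denominators t)) ⟩
    bound t ℚ.* D ℚ.* ℕ→ℚ (n C 3)
      ≡⟨ swap (bound t) D (ℕ→ℚ (n C 3)) ⟩
    bound t ℚ.* ℕ→ℚ (n C 3) ℚ.* D ∎))
  (ℚₚ.*-monoʳ-≤-nonNeg (ℕ→ℚ (n C 3)) {{ℚ.nonNegative (0≤fromℤ+ (n C 3))}}
    (subst (ℚ._≤ bound t ℚ.+ ε) (ℚₚ.+-identityʳ (bound t)) (ℚₚ.+-monoʳ-≤ (bound t) (ℚₚ.<⇒≤ 0<ε))))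
  where
  open ℚₚ.≤-Reasoning
  d p : ℤ
  d = + 12 * + t * + t
  p = + 12 * + t * + t - + 12 * + t - 1ℤ
  D : ℚ
  D = fromℤ d
  D-positive : ∀ t → .{{_ : ℕ.NonZero t}} → ℚ.Positive (fromℤ (+ 12 * + t * + t))
  D-positive (suc s) = ℚₚ.normalize-pos (12 ℕ.* suc s ℕ.* suc s) 1
  swap : ∀ a b c → a ℚ.* b ℚ.* c ≡ a ℚ.* c ℚ.* b
  swap = solve 3 (λ a b c → a :* b :* c := a :* c :* b) refl
    where open ℚ-Solver.+-*-Solver
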